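{- For every integer $n\ge 2$, $$\gamma_1^{\mathrm L}(P_n\square P_3)=3\left\lceil\frac{n}{2}\right\rceil.$$
   Context: All graphs are finite and simple; $N_G(u)$ is the open neighborhood of $u$ in $G$, and $P_n$ is the path on $n$ vertices. A set $D\subseteq V(G)$ is a dominating set if every vertex of $V(G)\setminus D$ has a neighbor in $D$. A dominating set $D$ of $G$ is a $1$-limited dominating set if $|N_G(u)\setminus D|\le 1$ for every $u\in D$. The $1$-limited domination number $\gamma_1^{\mathrm L}(G)$ is the minimum cardinality of a $1$-limited dominating set of $G$. The Cartesian product $G\square H$ has vertex set $V(G)\times V(H)$, with $(g,h)$ and $(g',h')$ adjacent if and only if either $g=g'$ and $hh'\in E(H)$, or $h=h'$ and $gg'\in E(G)$. -}

module Defs where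

open import Data.Fin.Base using (Fin; toℕ)
open import Data.Fin.Properties using (all?; any?; *↔×; inj⇒≟)
open import Data.Fin.Subset using (Subset; _∈_; ∣_∣; _─_; ⊤)
open import Data.Fin.Subset.Properties using (_∈?_; anySubset?; ∈⊤; p─⊤≡⊥; ∣⊥∣≡0)
open import Data.Nat.Base using (ℕ; suc; _*_; _≤_; _<_; z≤n)
open import Data.Nat.Induction using (<-wellFounded)
open import Data.Nat.Properties using (_≟_; _≤?_; _<?_; ≮⇒≥; ≤-trans; ≤-reflexive; 1+n≢n)
open import Data.Product.Base using (∃; _×_; _,_; proj₁; proj₂)
open import Data.Product.Function.NonDependent.Propositional using (_×-↔_)
open import Data.Sum.Base using (_⊎_; inj₁; inj₂; swap)
open import Data.Vec.Base using (tabulate)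
open import Function.Bundles using (_↔_; Inverse)
open import Function.Construct.Composition using (_↔-∘_)
open import Function.Construct.Identity using (↔-id)
open import Function.Construct.Symmetry using (↔-sym)
open import Function.Properties.Inverse using (↔⇒↣)
open import Induction.WellFounded using (Acc; acc)
open import Relation.Binary.Core using (Rel)
open import Relation.Binary.Definitions using (Decidable; DecidableEquality; Symmetric)
open import Relation.Binary.PropositionalEquality using (_≡_; refl; sym; subst; trans; cong)
open import Relation.Nullary.Decidable using (Dec; yes; no; does; map′; ¬?; _×-dec_; _⊎-dec_; _→-dec_)
open import Relation.Nullary.Negation using (¬_; contradiction)
open import Level using (0ℓ)

record Graph : Set₁ where
  field
    V          : Set
    order      : ℕ
    enum       : V ↔ Fin order
    Adj        : Rel V 0ℓ
    Adj?       : Decidable Adj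
    Adj-sym    : Symmetric Adj
    Adj-irrefl : ∀ {v} → ¬ Adj v v

  index : V → Fin order
  index = Inverse.to enum

  vertex : Fin order → V
  vertex = Inverse.from enum

  vertex-index : ∀ v → vertex (index v) ≡ v
  vertex-index v = Inverse.inverseʳ enum refl

  _≟ⱽ_ : DecidableEquality V
  _≟ⱽ_ = inj⇒≟ (↔⇒↣ enum)

  -- Sets of vertices are represented by their sets of indices.
  VertexSet : Set
  VertexSet = Subset order

  infix 4 _∈ⱽ_ _∉ⱽ_

  _∈ⱽ_ : V → VertexSet → Set
  v ∈ⱽ D = index v ∈ D

  _∉ⱽ_ : V → VertexSet → Set
  v ∉ⱽ D = ¬ (v ∈ⱽ D)

  N : V → VertexSet
  N u = tabulate (λ i → does (Adj? u (vertex i)))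

  Dominating : VertexSet → Set
  Dominating D = ∀ v → v ∉ⱽ D → ∃ λ u → u ∈ⱽ D × Adj v u

  OneLimitedDominating : VertexSet → Set
  OneLimitedDominating D =
    Dominating D × (∀ u → u ∈ⱽ D → ∣ N u ─ D ∣ ≤ 1)

  IsMinimumOneLimitedDominating : VertexSet → Set
  IsMinimumOneLimitedDominating D =
    OneLimitedDominating D × (∀ D′ → OneLimitedDominating D′ → ∣ D ∣ ≤ ∣ D′ ∣)

  allⱽ? : {Q : V → Set} → (∀ v → Dec (Q v)) → Dec (∀ v → Q v)
  allⱽ? {Q} Q? = map′ (λ q v → subst Q (vertex-index v) (q (index v)))
                      (λ q i → q (vertex i))
                      (all? (λ i → Q? (vertex i)))

  anyⱽ? : {Q : V → Set} → (∀ v → Dec (Q v)) → Dec (∃ Q)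
  anyⱽ? {Q} Q? = map′ (λ (i , q) → vertex i , q)
                      (λ (v , q) → index v , subst Q (sym (vertex-index v)) q)
                      (any? (λ i → Q? (vertex i)))

  oneLimitedDominating? : ∀ D → Dec (OneLimitedDominating D)
  oneLimitedDominating? D =
    allⱽ? (λ v → ¬? (index v ∈? D) →-dec anyⱽ? (λ u → (index u ∈? D) ×-dec Adj? v u))
    ×-dec
    allⱽ? (λ u → (index u ∈? D) →-dec (∣ N u ─ D ∣ ≤? 1))

  ⊤-oneLimitedDominating : OneLimitedDominating ⊤
  ⊤-oneLimitedDominating =
    (λ v v∉⊤ → contradiction ∈⊤ v∉⊤) ,
    (λ u _ → ≤-trans (≤-reflexive (trans (cong ∣_∣ (p─⊤≡⊥ (N u))) (∣⊥∣≡0 order))) z≤n)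

  minimumExists : ∃ IsMinimumOneLimitedDominating
  minimumExists = descend ⊤ ⊤-oneLimitedDominating (<-wellFounded ∣ ⊤ {order} ∣)
    where
    descend : ∀ D → OneLimitedDominating D → Acc _<_ ∣ D ∣ → ∃ IsMinimumOneLimitedDominating
    descend D h (acc rs)
      with anySubset? (λ D′ → oneLimitedDominating? D′ ×-dec (∣ D′ ∣ <? ∣ D ∣))
    ... | yes (D′ , h′ , lt) = descend D′ h′ (rs lt)
    ... | no none = D , h , λ D′ h′ → ≮⇒≥ (λ lt → none (D′ , h′ , lt))

  γ₁ᴸ : ℕ
  γ₁ᴸ = ∣ proj₁ minimumExists ∣

open Graph using (γ₁ᴸ) public

P : ℕ → Graph
P n = record
  { V          = Fin n
  ; order      = n
  ; enum       = ↔-id (Fin n)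
  ; Adj        = λ i j → suc (toℕ i) ≡ toℕ j ⊎ suc (toℕ j) ≡ toℕ i
  ; Adj?       = λ i j → (suc (toℕ i) ≟ toℕ j) ⊎-dec (suc (toℕ j) ≟ toℕ i)
  ; Adj-sym    = swap
  ; Adj-irrefl = λ { (inj₁ e) → 1+n≢n e ; (inj₂ e) → 1+n≢n e }
  }

infixl 7 _□_

_□_ : Graph → Graph → Graph
G □ H = record
  { V          = G.V × H.V
  ; order      = G.order * H.order
  ; enum       = ↔-sym *↔× ↔-∘ (G.enum ×-↔ H.enum)
  ; Adj        = λ (g , h) (g′ , h′) → (g ≡ g′ × H.Adj h h′) ⊎ (h ≡ h′ × G.Adj g g′)
  ; Adj?       = λ (g , h) (g′ , h′) →
                   ((g G.≟ⱽ g′) ×-dec H.Adj? h h′) ⊎-dec ((h H.≟ⱽ h′) ×-dec G.Adj? g g′)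
  ; Adj-sym    = λ { (inj₁ (e , a)) → inj₁ (sym e , H.Adj-sym a)
                   ; (inj₂ (e , a)) → inj₂ (sym e , G.Adj-sym a) }
  ; Adj-irrefl = λ { (inj₁ (_ , a)) → H.Adj-irrefl a
                   ; (inj₂ (_ , a)) → G.Adj-irrefl a }
  }
  where
  module G = Graph G
  module H = Graph H

{-# OPTIONS --safe #-}
module Submission where

-- Cut a vertex set of Pₙ □ P₃ into n columns, each a copy of P₃. Whether it is a 1-limited
-- dominating set depends only on the windows formed by a column and its two neighbours.
-- For the lower bound, a potential found by dynamic programming bounds the total size of the
-- k columns that follow given consecutive columns p, c; it grows by 3 whenever k grows
-- by 2, so that one step of the recursion is a finite check over all windows. The upper bound
-- is attained by the 4-periodic pattern empty, full, full, empty, whose last column is made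
-- full when n ≡ 1 mod 4.

open import Defs
import Data.Bool.Properties as Bool
open import Data.Fin.Base using (Fin; zero; suc; toℕ)
open import Data.Fin.Patterns using (0F; 1F; 2F)
open import Data.Fin.Properties as Fin using (all?; toℕ-injective)
open import Data.Fin.Subset using (Subset; Side; inside; outside; _∈_; _∉_; ∣_∣; _─_; ⊤; ⊥; ⁅_⁆)
open import Data.Fin.Subset.Properties
  using ( nonempty?; Empty-unique; ∣⊥∣≡0; ∣⁅x⁆∣≡1; x∈⁅x⁆; p⊆q⇒∣p∣≤∣q∣; p─q⊆p; anySubset?
        ; x∈p∧x∉q⇒x∈p─q; x∈p∧x≢y⇒x∈p-y; x∈p⇒∣p-x∣<∣p∣)
open import Data.Maybe.Base using (Maybe; just; nothing)
open import Data.Maybe.Relation.Unary.Any as Any using (Any; just)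
open import Data.Nat.Base using (ℕ; zero; suc; _+_; _*_; _∸_; _≤_; z≤n; s≤s; ⌈_/2⌉)
open import Data.Nat.Properties
  using ( ≤-trans; ≤-reflexive; ≤-antisym; ≤-<-trans; <⇒≱; _≤?_; suc-injective; +-cancelʳ-≡
        ; +-monoʳ-≤; +-assoc; +-comm; *-suc; *-distribˡ-+; m≤n+m∸n; module ≤-Reasoning)
open import Data.Product.Base using (∃; _×_; _,_; proj₁; proj₂)
open import Data.Sum.Base using (inj₁; inj₂)
open import Data.Vec.Base using (Vec; []; _∷_; _++_; there; lookup; concat; group; sum; map)
open import Data.Vec.Properties using (lookup-concat; lookup∘tabulate; []=⇒lookup; lookup⇒[]=)
open import Function.Base using (_∘_; flip)
open import Function.Bundles using (Inverse)
open import Level using (0ℓ)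
open import Relation.Binary.PropositionalEquality using (_≡_; refl; sym; trans; cong; subst)
open import Relation.Nullary.Decidable
  using (Dec; yes; no; map′; ¬?; _×-dec_; _→-dec_; decidable-stable; from-yes; dec-true)
open import Relation.Unary using (Pred; Decidable)

private
  variable
    n : ℕ

-- Finite subsets: size at most one, membership, exhaustive search.

∣p∣≤1⇒unique : {p : Subset n} → ∣ p ∣ ≤ 1 → ∀ {x y} → x ∈ p → y ∈ p → x ≡ y
∣p∣≤1⇒unique ∣p∣≤1 {x} {y} x∈p y∈p = decidable-stable (x Fin.≟ y) λ x≢y →
  <⇒≱ (≤-<-trans (≤-trans (s≤s z≤n) (x∈p⇒∣p-x∣<∣p∣ (x∈p∧x≢y⇒x∈p-y x∈p x≢y)))
                 (x∈p⇒∣p-x∣<∣p∣ y∈p))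
      ∣p∣≤1

unique⇒∣p∣≤1 : {p : Subset n} → (∀ {x y} → x ∈ p → y ∈ p → x ≡ y) → ∣ p ∣ ≤ 1
unique⇒∣p∣≤1 {n} {p} unique with nonempty? p
... | yes (x , x∈p) = ≤-trans (p⊆q⇒∣p∣≤∣q∣ λ y∈p → subst (_∈ ⁅ x ⁆) (unique x∈p y∈p) (x∈⁅x⁆ x))
                              (≤-reflexive (∣⁅x⁆∣≡1 x))
... | no empty = ≤-trans (≤-reflexive (trans (cong ∣_∣ (Empty-unique empty)) (∣⊥∣≡0 n))) z≤n

x∈p─q⇒x∉q : (p q : Subset n) → ∀ {x} → x ∈ p ─ q → x ∉ q
x∈p─q⇒x∉q (_ ∷ p) (inside  ∷ q) (there x∈p─q) (there x∈q) = x∈p─q⇒x∉q p q x∈p─q x∈q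
x∈p─q⇒x∉q (_ ∷ p) (outside ∷ q) (there x∈p─q) (there x∈q) = x∈p─q⇒x∉q p q x∈p─q x∈q

∣p++q∣≡∣p∣+∣q∣ : ∀ {m} (p : Subset m) (q : Subset n) → ∣ p ++ q ∣ ≡ ∣ p ∣ + ∣ q ∣
∣p++q∣≡∣p∣+∣q∣ []            q = refl
∣p++q∣≡∣p∣+∣q∣ (inside  ∷ p) q = cong suc (∣p++q∣≡∣p∣+∣q∣ p q)
∣p++q∣≡∣p∣+∣q∣ (outside ∷ p) q = ∣p++q∣≡∣p∣+∣q∣ p q

x∉p⇒outside : ∀ {x} {p : Subset n} → x ∉ p → lookup p x ≡ outside
x∉p⇒outside x∉p = Bool.¬-not (x∉p ∘ lookup⇒[]= _ _)

outside⇒x∉p : ∀ {x} {p : Subset n} → lookup p x ≡ outside → x ∉ p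
outside⇒x∉p e x∈p with () ← trans (sym e) ([]=⇒lookup x∈p)

allSubset? : {Q : Pred (Subset n) 0ℓ} → Decidable Q → Dec (∀ p → Q p)
allSubset? Q? = map′ (λ none p → decidable-stable (Q? p) (λ ¬q → none (p , ¬q)))
                     (λ all (p , ¬q) → ¬q (all p))
                     (¬? (anySubset? (¬? ∘ Q?)))

-- The 1-limited dominating condition at a single vertex.

-- `Is s v` says that v is present and lies on side s of the set; in a window that
-- extends beyond the grid some vertices are on neither side.
LocallyOk : (G : Graph) → (Side → Graph.V G → Set) → Graph.V G → Set
LocallyOk G Is u =
  (Is outside u → ∃ λ v → Adj u v × Is inside v) ×
  (Is inside u → ∀ v → Adj u v × Is outside v → ∀ w → Adj u w × Is outside w → v ≡ w)
  where open Graph G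

locallyOk? : ∀ G {Is} → (∀ s → Decidable (Is s)) → Decidable (LocallyOk G Is)
locallyOk? G Is? u =
  (Is? outside u →-dec anyⱽ? (λ v → Adj? u v ×-dec Is? inside v)) ×-dec
  (Is? inside u →-dec allⱽ? (λ v → (Adj? u v ×-dec Is? outside v) →-dec
                      allⱽ? (λ w → (Adj? u w ×-dec Is? outside w) →-dec (v ≟ⱽ w))))
  where open Graph G

locallyOk-present : ∀ G Is {u} → (∀ {s} → Is s u → LocallyOk G Is u) → LocallyOk G Is u
locallyOk-present G Is ok = (λ out → proj₁ (ok out) out) , (λ in′ → proj₂ (ok in′) in′)

module _ (G H : Graph) where
  private
    module G = Graph G
    module H = Graph H

  -- `R` matches the neighbours of `u` that lie on a side with those of `u′`. It is a relation
  -- because window positions beyond the grid have no partner. Dominators are carried along `to`.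
  -- Two outside neighbours of `u′` are pulled back by `from`, where they coincide, and
  -- functionality of `R` then makes the originals coincide.
  locallyOk-transfer :
    ∀ Is Is′ {u u′} (R : G.V → H.V → Set) →
    (∀ {v v′ w′} → R v v′ → R v w′ → v′ ≡ w′) →
    (∀ {s} → Is′ s u′ → Is s u) →
    (∀ {s v} → G.Adj u v × Is s v → ∃ λ v′ → R v v′ × H.Adj u′ v′ × Is′ s v′) →
    (∀ {s v′} → H.Adj u′ v′ × Is′ s v′ → ∃ λ v → R v v′ × G.Adj u v × Is s v) →
    LocallyOk G Is u → LocallyOk H Is′ u′
  locallyOk-transfer Is Is′ R functional centre to from (dominated , limited) =
    (λ out → let _ , q = dominated (centre out) ; v′ , _ , q′ = to q in v′ , q′) ,
    (λ in′ v′ q w′ r →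
      let v , Rvv′ , q′ = from q ; w , Rww′ , r′ = from r
      in functional Rvv′ (subst (λ x → R x w′) (sym (limited (centre in′) v q′ w r′)) Rww′))

module _ (G : Graph) where
  open Graph G

  private
    ∈N⇒Adj : ∀ {u i} → i ∈ N u → Adj u (vertex i)
    ∈N⇒Adj {u} {i} i∈N with Adj? u (vertex i) | trans (sym (lookup∘tabulate _ i)) ([]=⇒lookup i∈N)
    ... | yes a | _ = a

    Adj⇒∈N : ∀ {u v} → Adj u v → index v ∈ N u
    Adj⇒∈N {u} {v} a = lookup⇒[]= _ _ (trans (lookup∘tabulate _ (index v))
      (dec-true (Adj? u (vertex (index v))) (subst (Adj u) (sym (vertex-index v)) a)))

    index-vertex : ∀ i → index (vertex i) ≡ i
    index-vertex i = Inverse.inverseˡ enum refl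

  -- The bound `∣ N u ─ D ∣ ≤ 1` becomes equality of any two outside neighbours of `u`. This form
  -- mentions no ambient vertex set, so it can pass from the grid to a window.
  oneLimitedDominating⇒locallyOk : ∀ {D} → OneLimitedDominating D →
    ∀ u → LocallyOk G (λ s v → lookup D (index v) ≡ s) u
  oneLimitedDominating⇒locallyOk {D} (dominating , limited) u =
    (λ out → let v , v∈D , a = dominating u (outside⇒x∉p out) in v , a , []=⇒lookup v∈D) ,
    (λ in′ v (a , v-out) w (b , w-out) →
      trans (sym (vertex-index v)) (trans
        (cong vertex (∣p∣≤1⇒unique (limited u (lookup⇒[]= _ _ in′))
          (x∈p∧x∉q⇒x∈p─q (Adj⇒∈N a) (outside⇒x∉p v-out))
          (x∈p∧x∉q⇒x∈p─q (Adj⇒∈N b) (outside⇒x∉p w-out))))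
        (vertex-index w)))

  locallyOk⇒oneLimitedDominating : ∀ {D} →
    (∀ u → LocallyOk G (λ s v → lookup D (index v) ≡ s) u) → OneLimitedDominating D
  locallyOk⇒oneLimitedDominating {D} ok =
    (λ v v∉D → let u , a , u-in = proj₁ (ok v) (x∉p⇒outside v∉D) in u , lookup⇒[]= _ _ u-in , a) ,
    (λ u u∈D → unique⇒∣p∣≤1 λ {i} {j} i∈ j∈ →
      trans (sym (index-vertex i)) (trans
        (cong index (proj₂ (ok u) ([]=⇒lookup u∈D) (vertex i) (out u i∈) (vertex j) (out u j∈)))
        (index-vertex j)))
    where
    out : ∀ u {i} → i ∈ N u ─ D → Adj u (vertex i) × lookup D (index (vertex i)) ≡ outside
    out u {i} i∈ = ∈N⇒Adj (p─q⊆p (N u) D i∈) ,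
      trans (cong (lookup D) (index-vertex i)) (x∉p⇒outside (x∈p─q⇒x∉q (N u) D i∈))

-- Columns, windows, and their agreement with the grid.

Column : Set
Column = Subset 3

allMaybeColumn? : {Q : Pred (Maybe Column) 0ℓ} → Decidable Q → Dec (∀ x → Q x)
allMaybeColumn? Q? = map′ (λ { (n , _) nothing → n ; (_ , j) (just c) → j c })
                          (λ all → all nothing , all ∘ just)
                          (Q? nothing ×-dec allSubset? (Q? ∘ just))

-- Position (a , b) of the 3 × 3 window is row b of column a; `nothing` is a column
-- outside the grid.
WindowIs : Vec (Maybe Column) 3 → Side → Fin 3 × Fin 3 → Set
WindowIs w s (a , b) = Any (λ c → lookup c b ≡ s) (lookup w a)

Ok : (x y z : Maybe Column) → Set
Ok x y z = ∀ b → LocallyOk (P 3 □ P 3) (WindowIs (x ∷ y ∷ z ∷ [])) (1F , b)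

ok? : ∀ x y z → Dec (Ok x y z)
ok? x y z = all? λ b → locallyOk? (P 3 □ P 3)
  (λ s (a , b) → Any.dec (λ c → lookup c b Bool.≟ s) (lookup (x ∷ y ∷ z ∷ []) a)) (1F , b)

-- Index 0 is the left neighbour, so the window around column `m` starts at index `m` and needs no
-- subtraction. Past the end the value is `nothing`.
at : Maybe Column → Vec Column n → ℕ → Maybe Column
at p S       zero    = p
at p []      (suc m) = nothing
at p (c ∷ S) (suc m) = at (just c) S m

-- p is the column to the left of S.
Valid : Maybe Column → Vec Column n → Set
Valid p S = ∀ m → Ok (at p S m) (at p S (1 + m)) (at p S (2 + m))

at⁺ : ∀ {Q : Pred Column 0ℓ} p (S : Vec Column n) i → Q (lookup S i) → Any Q (at p S (suc (toℕ i)))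
at⁺ p (c ∷ S) zero    q = just q
at⁺ p (c ∷ S) (suc i) q = at⁺ (just c) S i q

at⁻ : ∀ {Q : Pred Column 0ℓ} p (S : Vec Column n) m → Any Q (at p S (suc m)) →
      ∃ λ i → suc (toℕ i) ≡ suc m × Q (lookup S i)
at⁻ p (c ∷ S) zero    (just q) = zero , refl , q
at⁻ p (c ∷ S) (suc m) q        = let i , e , q′ = at⁻ (just c) S m q in suc i , cong suc e , q′

at-nothing⁻ : ∀ {Q : Pred Column 0ℓ} (S : Vec Column n) m → Any Q (at nothing S m) →
              ∃ λ i → suc (toℕ i) ≡ m × Q (lookup S i)
at-nothing⁻ S (suc m) = at⁻ nothing S m

module _ {n : ℕ} (S : Vec Column n) where
  private
    G W : Graph
    G = P n □ P 3
    W = P 3 □ P 3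
    module G = Graph G
    module W = Graph W

    -- The product enumeration sends `(i , b)` to `combine i b`, which is the place of entry `b` of
    -- column `i` in `concat S`; hence the uses of `lookup-concat`.
    GridIs : Side → G.V → Set
    GridIs s v = lookup (concat S) (G.index v) ≡ s

    window : ℕ → Vec (Maybe Column) 3
    window m = at nothing S m ∷ at nothing S (1 + m) ∷ at nothing S (2 + m) ∷ []

    lookup-window : ∀ m a → lookup (window m) a ≡ at nothing S (toℕ a + m)
    lookup-window m 0F = refl
    lookup-window m 1F = refl
    lookup-window m 2F = refl

    -- Column a of the window around column i is column i + a - 1 of the grid.
    data Located (i : Fin n) : W.V → G.V → Set where
      located : ∀ {a i′ b} → suc (toℕ i′) ≡ toℕ a + toℕ i → Located i (a , b) (i′ , b)

    located-functional : ∀ {i v v′ w′} → Located i v v′ → Located i v w′ → v′ ≡ w′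
    located-functional (located e) (located e′) =
      cong (_, _) (toℕ-injective (suc-injective (trans e (sym e′))))

    located-injective : ∀ {i v w v′} → Located i v v′ → Located i w v′ → v ≡ w
    located-injective {i} (located e) (located e′) =
      cong (_, _) (toℕ-injective (+-cancelʳ-≡ (toℕ i) _ _ (trans (sym e) e′)))

    window⇒grid : ∀ {i s b v} → W.Adj (1F , b) v × WindowIs (window (toℕ i)) s v →
                  ∃ λ v′ → Located i v v′ × G.Adj (i , b) v′ × GridIs s v′
    window⇒grid {i} {s} {b} {a , b′} (adj , is)
      with i′ , e , is′ ← at-nothing⁻ S _ (subst (Any _) (lookup-window (toℕ i) a) is) =
      (i′ , b′) , located e , adjacent a adj e , trans (lookup-concat S i′ b′) is′
      where
      adjacent : ∀ a → W.Adj (1F , b) (a , b′) → suc (toℕ i′) ≡ toℕ a + toℕ i →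
                 G.Adj (i , b) (i′ , b′)
      adjacent 1F (inj₁ (refl , adj)) e = inj₁ (toℕ-injective (sym (suc-injective e)) , adj)
      adjacent 0F (inj₂ (refl , _)) e = inj₂ (refl , inj₂ e)
      adjacent 1F (inj₂ (refl , inj₁ ())) e
      adjacent 1F (inj₂ (refl , inj₂ ())) e
      adjacent 2F (inj₂ (refl , _)) e = inj₂ (refl , inj₁ (sym (suc-injective e)))

    grid⇒window : ∀ {i s b v′} → G.Adj (i , b) v′ × GridIs s v′ →
                  ∃ λ v → Located i v v′ × W.Adj (1F , b) v × WindowIs (window (toℕ i)) s v
    grid⇒window {i} {s} {b} {i′ , b′} (adj , is) =
      let a , e , adj′ = position adj in
      (a , b′) , located e , adj′ ,
      subst (Any _) (trans (cong (at nothing S) e) (sym (lookup-window (toℕ i) a)))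
            (at⁺ nothing S i′ (trans (sym (lookup-concat S i′ b′)) is))
      where
      position : G.Adj (i , b) (i′ , b′) →
                 ∃ λ a → suc (toℕ i′) ≡ toℕ a + toℕ i × W.Adj (1F , b) (a , b′)
      position (inj₁ (refl , adj)) = 1F , refl , inj₁ (refl , adj)
      position (inj₂ (refl , inj₁ e)) = 2F , cong suc (sym e) , inj₂ (refl , inj₁ refl)
      position (inj₂ (refl , inj₂ e)) = 0F , e , inj₂ (refl , inj₂ refl)

    centre⁺ : ∀ {i s b} → GridIs s (i , b) → WindowIs (window (toℕ i)) s (1F , b)
    centre⁺ {i} {s} {b} is = at⁺ nothing S i (trans (sym (lookup-concat S i b)) is)

    centre⁻ : ∀ {m s b} → WindowIs (window m) s (1F , b) → ∃ λ i → toℕ i ≡ m × GridIs s (i , b)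
    centre⁻ {m} {s} {b} is with i , e , is′ ← at-nothing⁻ S (suc m) is =
      i , suc-injective e , trans (lookup-concat S i b) is′

  oneLimitedDominating⇒valid : G.OneLimitedDominating (concat S) → Valid nothing S
  -- `m` may lie beyond the last column. There the centre is absent and both conditions are vacuous,
  -- so `m` may be taken to be `toℕ i` for a column `i` of the grid.
  oneLimitedDominating⇒valid h m b = locallyOk-present W (WindowIs (window m)) λ is → atCentre (centre⁻ is)
    where
    atCentre : ∀ {s} → (∃ λ i → toℕ i ≡ m × GridIs s (i , b)) →
               LocallyOk W (WindowIs (window m)) (1F , b)
    atCentre (i , refl , _) = locallyOk-transfer G W GridIs (WindowIs (window m)) (flip (Located i))
      located-injective
      (λ {s} is → let j , e , is′ = centre⁻ is in subst (λ k → GridIs s (k , b)) (toℕ-injective e) is′)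
      grid⇒window window⇒grid
      (oneLimitedDominating⇒locallyOk G h (i , b))

  valid⇒oneLimitedDominating : Valid nothing S → G.OneLimitedDominating (concat S)
  valid⇒oneLimitedDominating valid = locallyOk⇒oneLimitedDominating G λ (i , b) →
    locallyOk-transfer W G (WindowIs (window (toℕ i))) GridIs (Located i) located-functional centre⁺ window⇒grid grid⇒window
      (valid (toℕ i) b)

-- Lower bound: the potential.

total : Vec Column n → ℕ
total S = sum (map ∣_∣ S)

∣concat∣≡total : (S : Vec Column n) → ∣ concat S ∣ ≡ total S
∣concat∣≡total []      = refl
∣concat∣≡total (c ∷ S) = trans (∣p++q∣≡∣p∣+∣q∣ c (concat S)) (cong (∣ c ∣ +_) (∣concat∣≡total S))

-- What the potential retains, for an even or odd number of remaining columns, once 3 is taken off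
-- for every two of them while at least two remain. With no column remaining, a positive value of
-- `even` marks a pair that cannot end the grid.
even odd : (∣p∣ ∣c∣ : ℕ) → ℕ
even 3 _ = 0
even _ 0 = 3
even 1 1 = 2
even _ _ = 0
-- In a row missing from the previous column, the vertex of a full column already has its one
-- outside neighbour, so the next column must contain that row.
odd a 3 = 3 ∸ a
odd _ 2 = 2
odd _ _ = 3

potential : ℕ → Maybe Column → Column → ℕ
potential 0             (just p) c = even (∣ p ∣) (∣ c ∣)
potential 1             (just p) c = odd (∣ p ∣) (∣ c ∣)
potential 0             nothing  c = 3 ∸ ∣ c ∣
potential 1             nothing  c = 3 ∸ ∣ c ∣
potential (suc (suc k)) p        c = 3 + potential k p c

-- A genuine left column matters: in a one-column grid the two end vertices form a 1-limited
-- dominating set, yet `potential 0 nothing` is 1 at that column. This is where `2 ≤ n` enters.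
potential-end : ∀ p c → Ok (just p) (just c) nothing → potential 0 (just p) c ≤ 0
potential-end = from-yes (allSubset? λ p → allSubset? λ c →
  ok? (just p) (just c) nothing →-dec potential 0 (just p) c ≤? 0)

-- The window around d is needed to rule out pairs c, d that cannot occur.
potential-step : ∀ k p c d x → Ok p (just c) (just d) → Ok (just c) (just d) x →
                 potential (1 + k) p c ≤ ∣ d ∣ + potential k (just c) d
potential-step k p c d x w w′ = go k
  where
  initial : ∀ p c d → Ok p (just c) (just d) → ∀ x → Ok (just c) (just d) x →
            potential 1 p c ≤ ∣ d ∣ + potential 0 (just c) d ×
            potential 2 p c ≤ ∣ d ∣ + potential 1 (just c) d
  -- The first window is tested before `x` is chosen, so the search over `x` is confined to
  -- admissible triples.
  initial = from-yes (allMaybeColumn? λ p → allSubset? λ c → allSubset? λ d →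
    ok? p (just c) (just d) →-dec allMaybeColumn? λ x → ok? (just c) (just d) x →-dec
    ((potential 1 p c ≤? ∣ d ∣ + potential 0 (just c) d) ×-dec
     (potential 2 p c ≤? ∣ d ∣ + potential 1 (just c) d)))

  go : ∀ k → potential (1 + k) p c ≤ ∣ d ∣ + potential k (just c) d
  go 0 = proj₁ (initial p c d w x w′)
  go 1 = proj₂ (initial p c d w x w′)
  go (suc (suc k)) = begin
    3 + potential (1 + k) p c             ≤⟨ +-monoʳ-≤ 3 (go k) ⟩
    3 + (∣ d ∣ + potential k (just c) d)  ≡⟨ +-assoc 3 (∣ d ∣) _ ⟨
    (3 + ∣ d ∣) + potential k (just c) d  ≡⟨ cong (_+ potential k (just c) d) (+-comm 3 (∣ d ∣)) ⟩
    (∣ d ∣ + 3) + potential k (just c) d  ≡⟨ +-assoc (∣ d ∣) 3 _ ⟩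
    ∣ d ∣ + (3 + potential k (just c) d)  ∎
    where open ≤-Reasoning

-- `potential-step` telescopes along the columns and `potential-end` closes the sum. Starting from
-- two columns ensures that the last one has a left neighbour.
potential≤total : ∀ p c d (S : Vec Column n) → Valid p (c ∷ d ∷ S) →
                  potential (1 + n) p c ≤ total (d ∷ S)
potential≤total {n} p c d S valid =
  ≤-trans (potential-step n p c d _ (valid 0) (valid 1)) (+-monoʳ-≤ (∣ d ∣) (rest S valid))
  where
  rest : (S : Vec Column n) → Valid p (c ∷ d ∷ S) → potential n (just c) d ≤ total S
  rest []      valid = potential-end c d (valid 1)
  -- Dropping the first column only shifts the index of `at`, so validity of the tail is
  -- `valid ∘ suc` by computation.
  rest (e ∷ S) valid = potential≤total (just c) d e S (valid ∘ suc)

-- Here `k` columns follow the first one. The `nothing` clauses of `potential` top the first column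
-- up to 3, and every two further columns add 3 to both sides.
3⌈n/2⌉≤∣c∣+potential : ∀ k c → 3 * ⌈ 1 + k /2⌉ ≤ ∣ c ∣ + potential k nothing c
3⌈n/2⌉≤∣c∣+potential 0 c = m≤n+m∸n 3 (∣ c ∣)
3⌈n/2⌉≤∣c∣+potential 1 c = m≤n+m∸n 3 (∣ c ∣)
3⌈n/2⌉≤∣c∣+potential (suc (suc k)) c = begin
  3 * suc ⌈ 1 + k /2⌉                  ≡⟨ *-suc 3 ⌈ 1 + k /2⌉ ⟩
  3 + 3 * ⌈ 1 + k /2⌉                  ≤⟨ +-monoʳ-≤ 3 (3⌈n/2⌉≤∣c∣+potential k c) ⟩
  3 + (∣ c ∣ + potential k nothing c)  ≡⟨ +-assoc 3 (∣ c ∣) _ ⟨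
  (3 + ∣ c ∣) + potential k nothing c  ≡⟨ cong (_+ potential k nothing c) (+-comm 3 (∣ c ∣)) ⟩
  (∣ c ∣ + 3) + potential k nothing c  ≡⟨ +-assoc (∣ c ∣) 3 _ ⟩
  ∣ c ∣ + (3 + potential k nothing c)  ∎
  where open ≤-Reasoning

valid⇒3⌈n/2⌉≤total : 2 ≤ n → (S : Vec Column n) → Valid nothing S → 3 * ⌈ n /2⌉ ≤ total S
valid⇒3⌈n/2⌉≤total {suc (suc k)} _ (c ∷ d ∷ S) valid =
  ≤-trans (3⌈n/2⌉≤∣c∣+potential (1 + k) c) (+-monoʳ-≤ (∣ c ∣) (potential≤total nothing c d S valid))
valid⇒3⌈n/2⌉≤total {suc zero} (s≤s ())

-- Upper bound: the striped pattern.

stripes : ∀ n → Vec Column n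
stripes 0 = []
stripes 1 = ⊤ ∷ []
stripes 2 = ⊥ ∷ ⊤ ∷ []
stripes 3 = ⊥ ∷ ⊤ ∷ ⊤ ∷ []
stripes (suc (suc (suc (suc n)))) = ⊥ ∷ ⊤ ∷ ⊤ ∷ ⊥ ∷ stripes n

total-stripes : ∀ n → total (stripes n) ≡ 3 * ⌈ n /2⌉
total-stripes 0 = refl
total-stripes 1 = refl
total-stripes 2 = refl
total-stripes 3 = refl
total-stripes (suc (suc (suc (suc n)))) =
  trans (cong (6 +_) (total-stripes n)) (sym (*-distribˡ-+ 3 2 ⌈ n /2⌉))

[]-valid : ∀ p → Valid p []
[]-valid p m b = (λ ()) , (λ ())

∷-valid : ∀ {p c} {S : Vec Column n} →
          Ok p (just c) (at (just c) S 1) → Valid (just c) S → Valid p (c ∷ S)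
∷-valid w valid zero    = w
∷-valid w valid (suc m) = valid m

private
  -- In these windows one side is arbitrary. An empty column is dominated by a single full neighbour
  -- column. A vertex of a full column has no outside neighbour within its column, so a full or
  -- absent column on one side leaves at most one outside neighbour.
  ?⊥⊤ : ∀ p → Ok p (just ⊥) (just ⊤)
  ?⊥⊤ = from-yes (allMaybeColumn? λ p → ok? p (just ⊥) (just ⊤))

  ⊤⊥? : ∀ x → Ok (just ⊤) (just ⊥) x
  ⊤⊥? = from-yes (allMaybeColumn? λ x → ok? (just ⊤) (just ⊥) x)

  ?⊤| : ∀ p → Ok p (just ⊤) nothing
  ?⊤| = from-yes (allMaybeColumn? λ p → ok? p (just ⊤) nothing)

  ⊤⊤? : ∀ x → Ok (just ⊤) (just ⊤) x
  ⊤⊤? = from-yes (allMaybeColumn? λ x → ok? (just ⊤) (just ⊤) x)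

  ?⊤⊤ : ∀ p → Ok p (just ⊤) (just ⊤)
  ?⊤⊤ = from-yes (allMaybeColumn? λ p → ok? p (just ⊤) (just ⊤))

-- The left column `p` is arbitrary so that the induction can pass on the empty column ending each
-- period. The first window of every pattern tolerates any `p`.
stripes-valid : ∀ n p → Valid p (stripes n)
stripes-valid 0 p = []-valid p
stripes-valid 1 p = ∷-valid (?⊤| p) ([]-valid _)
stripes-valid 2 p = ∷-valid (?⊥⊤ p) (∷-valid (?⊤| _) ([]-valid _))
stripes-valid 3 p = ∷-valid (?⊥⊤ p) (∷-valid (?⊤⊤ _) (∷-valid (⊤⊤? _) ([]-valid _)))
stripes-valid (suc (suc (suc (suc n)))) p =
  ∷-valid (?⊥⊤ p) (∷-valid (?⊤⊤ _) (∷-valid (⊤⊤? _) (∷-valid (⊤⊥? _) (stripes-valid n _))))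

theorem16 : ∀ (n : ℕ) → 2 ≤ n → γ₁ᴸ (P n □ P 3) ≡ 3 * ⌈ n /2⌉
theorem16 n 2≤n = ≤-antisym upper (lower D D-ok)
  where
  open Graph (P n □ P 3) using (minimumExists; OneLimitedDominating)

  D : Subset (n * 3)
  D = proj₁ minimumExists

  D-ok : OneLimitedDominating D
  D-ok = proj₁ (proj₂ minimumExists)

  upper : ∣ D ∣ ≤ 3 * ⌈ n /2⌉
  upper = ≤-trans
    (proj₂ (proj₂ minimumExists) (concat (stripes n))
      (valid⇒oneLimitedDominating (stripes n) (stripes-valid n nothing)))
    (≤-reflexive (trans (∣concat∣≡total (stripes n)) (total-stripes n)))

  lower : ∀ D → OneLimitedDominating D → 3 * ⌈ n /2⌉ ≤ ∣ D ∣
  -- `group` writes an arbitrary vertex set as `concat S`, so a bound on sequences of columns covers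
  -- every set.
  lower D ok with S , refl ← group n 3 D =
    ≤-trans (valid⇒3⌈n/2⌉≤total 2≤n S (oneLimitedDominating⇒valid S ok))
            (≤-reflexive (sym (∣concat∣≡total S)))
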